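{- Let $a$ and $b$ be coprime positive integers, and let $w\in S_a$ be a permutation with $k$ cycles (fixed points counted as cycles). Then the number of $(a,b)$-parking functions fixed by $w$ equals $b^{k-1}$. In particular, the number of $(a,b)$-parking functions is $|\mathsf{PF}_{a,b}|=b^{a-1}$.
   Context: An $(a,b)$-Dyck path is a lattice path from $(0,0)$ to $(b,a)$ consisting of $a$ unit north steps and $b$ unit east steps that stays weakly above the line $y=\frac{a}{b}x$. An $(a,b)$-parking function is an $(a,b)$-Dyck path together with a bijective labeling of its $a$ north steps by $\{1,2,\ldots,a\}$ such that the labels increase going north within each column (i.e. among north steps with the same $x$-coordinate). $\mathsf{PF}_{a,b}$ is the set of $(a,b)$-parking functions. The symmetric group $S_a$ acts on $\mathsf{PF}_{a,b}$ by permuting the labels and then re-sorting the labels within each column into increasing order. -}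

module Defs where

open import Data.Empty using (⊥-elim)
open import Data.Fin.Base using (Fin; zero; suc)
import Data.Fin.Base as Fin
import Data.Fin.Properties as Fin
open import Data.Fin.Permutation using (Permutation′; _⟨$⟩ʳ_; inverseˡ; inverseʳ; _⟨$⟩ˡ_)
open import Data.List.Base using (List; []; _∷_; _++_; map; lookup)
open import Data.List.Properties using (tabulate-lookup)
open import Data.List.Membership.Propositional using (_∈_; _∉_)
open import Data.List.Membership.Propositional.Properties using (∈-lookup; ∈-map⁺)
open import Data.List.Relation.Binary.Permutation.Propositional
  using (_↭_; prep; swap; ↭-refl; ↭-sym; ↭-trans; ↭⇒↭ₛ)
open import Data.List.Relation.Binary.Permutation.Propositional.Properties using (∈-resp-↭)
import Data.List.Relation.Binary.Permutation.Setoid.Properties as Permutationₛ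
import Data.List.Relation.Unary.All as All
open import Data.List.Relation.Unary.AllPairs using ([]; _∷_)
open import Data.List.Relation.Unary.Any using (here; there; index)
open import Data.List.Relation.Unary.Any.Properties using (lookup-index)
open import Data.List.Relation.Unary.Linked using (Linked; []; [-]; _∷_)
open import Data.List.Relation.Unary.Unique.Propositional using (Unique)
import Data.List.Relation.Unary.Unique.Propositional.Properties as Unique
open import Data.Nat.Base using (ℕ; suc; _*_; _≤_)
import Data.Nat.Properties as ℕ
open import Data.Product.Base using (Σ; _,_; proj₁; proj₂)
open import Data.Unit.Base using (⊤; tt)
open import Function.Base using (_∘_)
open import Function.Bundles using (Inverse)
open import Function.Definitions using (Injective; Bijective)
open import Level using (_⊔_; 0ℓ)
open import Relation.Binary.Bundles using (Setoid)
import Relation.Binary.Construct.Closure.Equivalence as EqClosure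
import Relation.Binary.Construct.On as On
open import Relation.Binary.PropositionalEquality
  using (_≡_; refl; sym; trans; cong; subst; setoid)
open import Relation.Nullary.Decidable using (yes; no)

private
  variable
    a b : ℕ
    L M : Set

infix 4 _HasSize_ _⊏_

_HasSize_ : ∀ {c ℓ} → Setoid c ℓ → ℕ → Set (c ⊔ ℓ)
S HasSize n = Inverse S (setoid (Fin n))

-- The cycles of w are the classes of the equivalence relation generated by
-- i ~ w i, so a fixed point is a class of its own.
Cycles : Permutation′ a → Setoid 0ℓ 0ℓ
Cycles w = EqClosure.setoid (λ i j → w ⟨$⟩ʳ i ≡ j)

------------------------------------------------------------------------
-- Lattice paths

-- A path is read from (0,0) upwards; its north steps carry labels in L.
data Step (L : Set) : Set where
  north : L → Step L
  east  : Step L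

relabel : (L → M) → List (Step L) → List (Step M)
relabel f []            = []
relabel f (north l ∷ p) = north (f l) ∷ relabel f p
relabel f (east ∷ p)    = east ∷ relabel f p

shape : List (Step L) → List (Step ⊤)
shape = relabel (λ _ → tt)

#north #east : List (Step L) → ℕ
#north []            = 0
#north (north _ ∷ p) = suc (#north p)
#north (east ∷ p)    = #north p
#east []            = 0
#east (north _ ∷ p) = #east p
#east (east ∷ p)    = suc (#east p)

-- The vertices of a path are the endpoints (#east q , #north q) of its
-- prefixes q, and such a vertex is weakly above the line y = (a/b) x
-- iff a * #east q ≤ b * #north q.
record IsDyck (a b : ℕ) (p : List (Step ⊤)) : Set where
  field
    norths : #north p ≡ a
    easts  : #east p ≡ b
    above  : ∀ q r → p ≡ q ++ r → a * #east q ≤ b * #north q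

------------------------------------------------------------------------
-- Parking functions

labels : List (Step L) → List L
labels []            = []
labels (north l ∷ p) = l ∷ labels p
labels (east ∷ p)    = labels p

-- North steps with the same x-coordinate are consecutive steps of the path,
-- so columns increase iff any two adjacent steps are related by _⊏_.
_⊏_ : Step (Fin a) → Step (Fin a) → Set
north i ⊏ north j = i Fin.< j
north _ ⊏ east    = ⊤
east    ⊏ _       = ⊤

-- The labels 1, …, a are represented by Fin a.
record ParkingFunction (a b : ℕ) : Set where
  field
    path       : List (Step (Fin a))
    dyck       : IsDyck a b (shape path)
    bijective  : Bijective _≡_ _≡_ (lookup (labels path))
    increasing : Linked _⊏_ path

open ParkingFunction

-- Parking functions are equal when their labelled paths are.
PF : ℕ → ℕ → Setoid 0ℓ 0ℓ
PF a b = On.setoid {B = ParkingFunction a b} (setoid (List (Step (Fin a)))) path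

------------------------------------------------------------------------
-- The action of the symmetric group

-- Insertion sort of each maximal run of north steps.
insert : Fin a → List (Step (Fin a)) → List (Step (Fin a))
insert i []            = north i ∷ []
insert i (east ∷ p)    = north i ∷ east ∷ p
insert i (north j ∷ p) with i Fin.≤? j
... | yes _ = north i ∷ north j ∷ p
... | no  _ = north j ∷ insert i p

sortColumns : List (Step (Fin a)) → List (Step (Fin a))
sortColumns []            = []
sortColumns (north i ∷ p) = insert i (sortColumns p)
sortColumns (east ∷ p)    = east ∷ sortColumns p

shape-relabel : (f : L → M) (p : List (Step L)) → shape (relabel f p) ≡ shape p
shape-relabel f []            = refl
shape-relabel f (north l ∷ p) = cong (north tt ∷_) (shape-relabel f p)
shape-relabel f (east ∷ p)    = cong (east ∷_) (shape-relabel f p)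

shape-insert : (i : Fin a) (p : List (Step (Fin a))) →
               shape (insert i p) ≡ north tt ∷ shape p
shape-insert i []            = refl
shape-insert i (east ∷ p)    = refl
shape-insert i (north j ∷ p) with i Fin.≤? j
... | yes _ = refl
... | no  _ = cong (north tt ∷_) (shape-insert i p)

shape-sortColumns : (p : List (Step (Fin a))) → shape (sortColumns p) ≡ shape p
shape-sortColumns []            = refl
shape-sortColumns (north i ∷ p) =
  trans (shape-insert i (sortColumns p)) (cong (north tt ∷_) (shape-sortColumns p))
shape-sortColumns (east ∷ p)    = cong (east ∷_) (shape-sortColumns p)

labels-relabel : (f : L → M) (p : List (Step L)) → labels (relabel f p) ≡ map f (labels p)
labels-relabel f []            = refl
labels-relabel f (north l ∷ p) = cong (f l ∷_) (labels-relabel f p)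
labels-relabel f (east ∷ p)    = labels-relabel f p

labels-insert : (i : Fin a) (p : List (Step (Fin a))) → labels (insert i p) ↭ i ∷ labels p
labels-insert i []            = ↭-refl
labels-insert i (east ∷ p)    = ↭-refl
labels-insert i (north j ∷ p) with i Fin.≤? j
... | yes _ = ↭-refl
... | no  _ = ↭-trans (prep j (labels-insert i p)) (swap j i ↭-refl)

labels-sortColumns : (p : List (Step (Fin a))) → labels (sortColumns p) ↭ labels p
labels-sortColumns []            = ↭-refl
labels-sortColumns (north i ∷ p) =
  ↭-trans (labels-insert i (sortColumns p)) (prep i (labels-sortColumns p))
labels-sortColumns (east ∷ p)    = labels-sortColumns p

Unique-resp-↭ : {xs ys : List L} → xs ↭ ys → Unique xs → Unique ys
Unique-resp-↭ {L = L} xs↭ys = Permutationₛ.Unique-resp-↭ (setoid L) (↭⇒↭ₛ xs↭ys)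

bijective⇒unique : {xs : List L} → Bijective _≡_ _≡_ (lookup xs) → Unique xs
bijective⇒unique {xs = xs} (inj , _) =
  subst Unique (tabulate-lookup xs) (Unique.tabulate⁺ inj)

bijective⇒∈ : {xs : List L} → Bijective _≡_ _≡_ (lookup xs) → ∀ x → x ∈ xs
bijective⇒∈ {xs = xs} (_ , surj) x with k , eq ← surj x = subst (_∈ xs) (eq refl) (∈-lookup k)

unique⇒injective : {xs : List L} → Unique xs → Injective _≡_ _≡_ (lookup xs)
unique⇒injective (x∉ ∷ u) {zero}  {zero}  eq = refl
unique⇒injective (x∉ ∷ u) {zero}  {suc j} eq = ⊥-elim (All.lookup x∉ (∈-lookup j) eq)
unique⇒injective (x∉ ∷ u) {suc i} {zero}  eq = ⊥-elim (All.lookup x∉ (∈-lookup i) (sym eq))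
unique⇒injective (x∉ ∷ u) {suc i} {suc j} eq = cong suc (unique⇒injective u eq)

unique∧∈⇒bijective : {xs : List L} → Unique xs → (∀ x → x ∈ xs) → Bijective _≡_ _≡_ (lookup xs)
unique∧∈⇒bijective u all∈ =
  unique⇒injective u , λ x → index (all∈ x) , λ { refl → sym (lookup-index (all∈ x)) }

private
  ⊏-insert : (i j : Fin a) (p : List (Step (Fin a))) → j Fin.< i →
             Linked _⊏_ (north j ∷ p) → Linked _⊏_ (insert i p) →
             Linked _⊏_ (north j ∷ insert i p)
  ⊏-insert i j []            j<i _ l = j<i ∷ l
  ⊏-insert i j (east ∷ p)    j<i _ l = j<i ∷ l
  ⊏-insert i j (north k ∷ p) j<i (j<k ∷ _) l with i Fin.≤? k
  ... | yes _ = j<i ∷ l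
  ... | no  _ = j<k ∷ l

  tail : {s : Step (Fin a)} {p : List (Step (Fin a))} → Linked _⊏_ (s ∷ p) → Linked _⊏_ p
  tail [-]     = []
  tail (_ ∷ l) = l

  east-∷ : {p : List (Step (Fin a))} → Linked _⊏_ p → Linked _⊏_ (east ∷ p)
  east-∷ []      = [-]
  east-∷ [-]     = tt ∷ [-]
  east-∷ (r ∷ l) = tt ∷ r ∷ l

insert-increasing : (i : Fin a) (p : List (Step (Fin a))) → i ∉ labels p →
                    Linked _⊏_ p → Linked _⊏_ (insert i p)
insert-increasing i []            i∉ l = [-]
insert-increasing i (east ∷ p)    i∉ l = tt ∷ l
insert-increasing i (north j ∷ p) i∉ l with i Fin.≤? j
... | yes i≤j = Fin.≤∧≢⇒< i≤j (i∉ ∘ here) ∷ l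
... | no  i≰j = ⊏-insert i j p (ℕ.≰⇒> i≰j) l (insert-increasing i p (i∉ ∘ there) (tail l))

sortColumns-increasing : (p : List (Step (Fin a))) → Unique (labels p) →
                         Linked _⊏_ (sortColumns p)
sortColumns-increasing []            u        = []
sortColumns-increasing (north i ∷ p) (i∉ ∷ u) =
  insert-increasing i (sortColumns p)
    (λ i∈ → All.lookup i∉ (∈-resp-↭ (labels-sortColumns p) i∈) refl)
    (sortColumns-increasing p u)
sortColumns-increasing (east ∷ p)    u        = east-∷ (sortColumns-increasing p u)

act : Permutation′ a → ParkingFunction a b → ParkingFunction a b
act {a} {b} w P = record
  { path       = sortColumns p
  ; dyck       = subst (IsDyck a b)
                   (sym (trans (shape-sortColumns p) (shape-relabel (w ⟨$⟩ʳ_) (path P)))) (dyck P)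
  ; bijective  = unique∧∈⇒bijective (Unique-resp-↭ (↭-sym (labels-sortColumns p)) unique)
                   (λ i → ∈-resp-↭ (↭-sym (labels-sortColumns p)) (all∈ i))
  ; increasing = sortColumns-increasing p unique
  }
  where
  p : List (Step (Fin a))
  p = relabel (w ⟨$⟩ʳ_) (path P)

  w-injective : ∀ {i j} → w ⟨$⟩ʳ i ≡ w ⟨$⟩ʳ j → i ≡ j
  w-injective eq = trans (sym (inverseˡ w)) (trans (cong (w ⟨$⟩ˡ_) eq) (inverseˡ w))

  unique : Unique (labels p)
  unique = subst Unique (sym (labels-relabel (w ⟨$⟩ʳ_) (path P)))
             (Unique.map⁺ w-injective (bijective⇒unique (bijective P)))

  all∈ : ∀ i → i ∈ labels p
  all∈ i = subst (i ∈_) (sym (labels-relabel (w ⟨$⟩ʳ_) (path P)))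
             (subst (_∈ map (w ⟨$⟩ʳ_) (labels (path P))) (inverseʳ w)
               (∈-map⁺ (w ⟨$⟩ʳ_) (bijective⇒∈ (bijective P) (w ⟨$⟩ˡ i))))

Fixed : (b : ℕ) → Permutation′ a → Setoid 0ℓ 0ℓ
Fixed {a} b w = On.setoid {B = Σ (ParkingFunction a b) (λ P → act w P ≈ P)} (PF a b) proj₁
  where open Setoid (PF a b) using (_≈_)

{-# OPTIONS --safe #-}
module Submission where

-- A parking function is determined by the map f : Fin a → Fin b sending each label to the
-- x-coordinate of its north step, and f arises from a parking function iff the heights
-- b · #{i : f i < x} − a · x are nonnegative. The action of w permutes the labels, so the
-- parking functions fixed by w are those for which f is constant on the cycles of w.
-- Cycle lemma: modulo b, exactly one of the b translates of f is a parking function, namely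
-- the one starting at the lowest height, which is unique as the b heights in a period are
-- distinct modulo b by coprimality. Hence f can be recovered from its values relative to
-- the value on a chosen cycle, and these k − 1 values are arbitrary.

open import Defs
open import Data.Nat.Base
open import Data.Nat.Coprimality using (Coprime; coprime-divisor) renaming (sym to coprime-sym)
open import Data.Fin.Permutation using (Permutation′; _⟨$⟩ʳ_; _⟨$⟩ˡ_; inverseʳ)
open import Data.Product.Base using (∃; ∃₂; _×_; _,_; proj₁; proj₂)

open import Data.Empty using (⊥-elim)
open import Data.Fin.Base using (Fin; zero; suc; toℕ; fromℕ; fromℕ<; inject₁; combine; funToFin; finToFun)
import Data.Fin.Base as Fin
open import Data.Fin.Properties
  using (toℕ-fromℕ; toℕ-inject₁; toℕ<n; toℕ-injective; toℕ≤pred[n]; finToFun-funToFin; funToFin-finToFin)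
import Data.Fin.Properties as Fin
open import Data.List.Base using (List; []; _∷_; _++_; map; length; allFin; upTo; replicate; foldr)
open import Data.List.Extrema.Nat using (argmin; f[argmin]≤f[xs]; argmin-all)
open import Data.List.Membership.Propositional using (_∈_)
open import Data.List.Membership.Propositional.Properties using (∈-allFin; ∈-upTo⁺; ∈-upTo⁻)
open import Data.List.Membership.Propositional.Properties.WithK using (unique∧set⇒bag)
open import Data.List.Properties using (length-tabulate; map-cong)
open import Data.List.Relation.Binary.BagAndSetEquality using (∼bag⇒↭)
open import Data.List.Relation.Binary.Permutation.Propositional using (_↭_; prep; swap; ↭-refl; ↭-sym; ↭-trans)
open import Data.List.Relation.Binary.Permutation.Propositional.Properties using (↭-length; map⁺; ∈-resp-↭)
import Data.List.Relation.Unary.All as All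
open import Data.List.Relation.Unary.AllPairs using (_∷_)
import Data.List.Relation.Unary.Any as Any
open import Data.List.Relation.Unary.Linked using (Linked; _∷_; tail)
open import Data.List.Relation.Unary.Unique.Propositional using (Unique)
open import Data.List.Relation.Unary.Unique.Propositional.Properties using (allFin⁺)
open import Data.Nat.Divisibility using (_∣_; divides)
open import Data.Nat.DivMod using (_/_; _%_; m≡m%n+[m/n]*n; m%n<n)
open import Data.Nat.ListAction using (sum)
open import Data.Nat.ListAction.Properties using (sum-↭)
open import Data.Nat.Properties
open import Data.Nat.Tactic.RingSolver using (solve-∀)
open import Data.Unit.Base using (tt)
open import Function.Base using (_∘_; id; _$_)
open import Function.Bundles using (Inverse; mk⇔)
open import Function.Construct.Composition using (inverse)
open import Level using (0ℓ)
open import Relation.Binary.Bundles using (Setoid)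
import Relation.Binary.Construct.Closure.Equivalence as EqClosure
import Relation.Binary.Construct.On as On
open import Relation.Binary.PropositionalEquality
open import Relation.Nullary.Decidable using (yes; no)

open ParkingFunction
open IsDyck

private
  variable
    A L M : Set
    a k n : ℕ

-- Sums over lists.

sum-map-+ : (u v : A → ℕ) (xs : List A) →
            sum (map (λ x → u x + v x) xs) ≡ sum (map u xs) + sum (map v xs)
sum-map-+ u v []       = refl
sum-map-+ u v (x ∷ xs) = trans (cong (u x + v x +_) (sum-map-+ u v xs)) (interchange (u x) (v x) _ _)
  where
  interchange : ∀ p q r s → (p + q) + (r + s) ≡ (p + r) + (q + s)
  interchange = solve-∀

sum-map-const : (m : ℕ) (xs : List A) → sum (map (λ _ → m) xs) ≡ length xs * m
sum-map-const m []       = refl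
sum-map-const m (x ∷ xs) = cong (m +_) (sum-map-const m xs)

-- Subtraction modulo `suc n` and visits to zero.

infixl 6 _⊖_

-- v ⊖ y is v − y modulo suc n, and visits v y is the number of t < y with v ⊖ t ≡ zero.
_⊖_ : Fin (suc n) → ℕ → Fin (suc n)
v     ⊖ zero  = v
zero  ⊖ suc y = fromℕ _ ⊖ y
suc v ⊖ suc y = inject₁ v ⊖ y

visits : Fin (suc n) → ℕ → ℕ
visits     v       zero    = 0
visits {n} zero    (suc y) = suc (visits (fromℕ n) y)
visits     (suc v) (suc y) = visits (inject₁ v) y

⊖-+ : (v : Fin (suc n)) (x y : ℕ) → v ⊖ (x + y) ≡ v ⊖ x ⊖ y
⊖-+ v       zero    y = refl
⊖-+ zero    (suc x) y = ⊖-+ (fromℕ _) x y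
⊖-+ (suc v) (suc x) y = ⊖-+ (inject₁ v) x y

visits-+ : (v : Fin (suc n)) (x y : ℕ) → visits v (x + y) ≡ visits v x + visits (v ⊖ x) y
visits-+ v       zero    y = refl
visits-+ zero    (suc x) y = cong suc (visits-+ (fromℕ _) x y)
visits-+ (suc v) (suc x) y = visits-+ (inject₁ v) x y

⊖-comm : (v : Fin (suc n)) (x y : ℕ) → v ⊖ x ⊖ y ≡ v ⊖ y ⊖ x
⊖-comm v x y = trans (sym (⊖-+ v x y)) (trans (cong (v ⊖_) (+-comm x y)) (⊖-+ v y x))

⊖-≤ : (v u : Fin (suc n)) (x : ℕ) → toℕ v ≡ x + toℕ u → v ⊖ x ≡ u
⊖-≤ v       u zero    eq = toℕ-injective eq
⊖-≤ (suc v) u (suc x) eq = ⊖-≤ (inject₁ v) u x (trans (toℕ-inject₁ v) (suc-injective eq))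

v⊖v≡0 : (v : Fin (suc n)) → v ⊖ toℕ v ≡ zero
v⊖v≡0 v = ⊖-≤ v zero (toℕ v) (sym (+-identityʳ (toℕ v)))

-- The first step wraps around to `fromℕ n`; the remaining `n ∸ toℕ v` steps descend to `v`.
zero⊖-surjective : (v : Fin (suc n)) → zero ⊖ (suc n ∸ toℕ v) ≡ v
zero⊖-surjective {n} v = begin
  zero ⊖ (suc n ∸ toℕ v)   ≡⟨ cong (zero ⊖_) (+-∸-assoc 1 (toℕ≤pred[n] v)) ⟩
  fromℕ n ⊖ (n ∸ toℕ v)    ≡⟨ ⊖-≤ (fromℕ n) v _ (trans (toℕ-fromℕ n) (sym (m∸n+n≡m (toℕ≤pred[n] v)))) ⟩
  v                        ∎
  where open ≡-Reasoning

-- Every `v` is a translate of `zero`, and translations commute.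
zero-fixed⇒fixed : {y : ℕ} → zero {n} ⊖ y ≡ zero → (v : Fin (suc n)) → v ⊖ y ≡ v
zero-fixed⇒fixed {n} {y} eq v = begin
  v ⊖ y                       ≡⟨ cong (_⊖ y) (zero⊖-surjective v) ⟨
  zero ⊖ (suc n ∸ toℕ v) ⊖ y  ≡⟨ ⊖-comm zero (suc n ∸ toℕ v) y ⟩
  zero ⊖ y ⊖ (suc n ∸ toℕ v)  ≡⟨ cong (_⊖ (suc n ∸ toℕ v)) eq ⟩
  zero ⊖ (suc n ∸ toℕ v)      ≡⟨ zero⊖-surjective v ⟩
  v                           ∎
  where open ≡-Reasoning

⊖-modulus : (v : Fin (suc n)) → v ⊖ suc n ≡ v
⊖-modulus {n} = zero-fixed⇒fixed {y = suc n} (zero⊖-surjective zero)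

⊖-period : (v : Fin (suc n)) (q : ℕ) → v ⊖ q * suc n ≡ v
⊖-period     v zero    = refl
⊖-period {n} v (suc q) = begin
  v ⊖ (suc n + q * suc n)  ≡⟨ ⊖-+ v (suc n) _ ⟩
  v ⊖ suc n ⊖ q * suc n    ≡⟨ cong (_⊖ q * suc n) (⊖-modulus v) ⟩
  v ⊖ q * suc n            ≡⟨ ⊖-period v q ⟩
  v                        ∎
  where open ≡-Reasoning

-- The indicator of `y < x`, a number so that it can be summed over labels.
below : ℕ → ℕ → ℕ
below _       zero    = 0
below zero    (suc _) = 1
below (suc y) (suc x) = below y x

<⇒below≡1 : ∀ {y x} → y < x → below y x ≡ 1
<⇒below≡1 {zero}  (s<s _)   = refl
<⇒below≡1 {suc y} (s<s y<x) = <⇒below≡1 y<x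

visits-≤ : (v : Fin (suc n)) (x : ℕ) → x ≤ toℕ v → visits v x ≡ 0
visits-≤ v       zero    _         = refl
visits-≤ (suc v) (suc x) (s≤s x≤v) = visits-≤ (inject₁ v) x (subst (x ≤_) (sym (toℕ-inject₁ v)) x≤v)

-- Within one period the walk down from `v` meets `zero` exactly once, after `toℕ v` steps. The
-- bound on `x` is sharp: started at `zero`, the walk is back there after `suc n` steps.
visits≡below : (v : Fin (suc n)) {x : ℕ} → x ≤ suc n → visits v x ≡ below (toℕ v) x
visits≡below         v       {zero}  _       = refl
visits≡below {n}     zero    {suc x} (s≤s x≤n) =
  cong suc (visits-≤ (fromℕ n) x (subst (x ≤_) (sym (toℕ-fromℕ n)) x≤n))
visits≡below         (suc v) {suc x} (s≤s x≤n) =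
  trans (visits≡below (inject₁ v) (m≤n⇒m≤1+n x≤n)) (cong (λ y → below y x) (toℕ-inject₁ v))

visits-period : (v : Fin (suc n)) (q r : ℕ) → visits v (q * suc n + r) ≡ q + visits v r
visits-period     v zero    r = refl
visits-period {n} v (suc q) r = begin
  visits v (suc n + q * suc n + r)                          ≡⟨ cong (visits v) (+-assoc (suc n) _ r) ⟩
  visits v (suc n + (q * suc n + r))                        ≡⟨ visits-+ v (suc n) _ ⟩
  visits v (suc n) + visits (v ⊖ suc n) (q * suc n + r)     ≡⟨ cong₂ _+_ once
                                                                 (cong (λ u → visits u (q * suc n + r)) (⊖-modulus v)) ⟩
  1 + visits v (q * suc n + r)                              ≡⟨ cong suc (visits-period v q r) ⟩
  suc q + visits v r                                        ∎
  where
  open ≡-Reasoning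
  once : visits v (suc n) ≡ 1
  once = trans (visits≡below v ≤-refl) (<⇒below≡1 (toℕ<n v))

-- Ballot functions and their heights.

-- For x ≤ suc n this is #{i : f i < x}; beyond, it is continued by total-period.
total : (Fin a → Fin (suc n)) → ℕ → ℕ
total f x = sum (map (λ i → visits (f i) x) (allFin _))

-- The Dyck condition at every `x`, not only up to `suc n`, so that comparisons of heights may run
-- past the end of a period.
Ballot : (Fin a → Fin (suc n)) → Set
Ballot {a} {n} f = ∀ x → a * x ≤ suc n * total f x

total-cong : {f g : Fin a → Fin (suc n)} → f ≗ g → total f ≗ total g
total-cong f≗g x = cong sum (map-cong (λ i → cong (λ v → visits v x) (f≗g i)) (allFin _))

Ballot-resp-≗ : {f g : Fin a → Fin (suc n)} → f ≗ g → Ballot f → Ballot g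
Ballot-resp-≗ {a} {n} f≗g D x = subst (λ m → a * x ≤ suc n * m) (total-cong f≗g x) (D x)

total-+ : (f : Fin a → Fin (suc n)) (x y : ℕ) →
          total f (x + y) ≡ total f x + total (λ i → f i ⊖ x) y
total-+ {a} f x y = trans (cong sum (map-cong (λ i → visits-+ (f i) x y) (allFin a)))
                          (sum-map-+ (λ i → visits (f i) x) _ (allFin a))

sum-const-allFin : (m : ℕ) → sum (map (λ _ → m) (allFin a)) ≡ a * m
sum-const-allFin {a} m = trans (sum-map-const m (allFin a)) (cong (_* m) (length-tabulate {n = a} id))

total-period : (f : Fin a → Fin (suc n)) (q r : ℕ) → total f (q * suc n + r) ≡ a * q + total f r
total-period {a} {n} f q r = begin
  total f (q * suc n + r)                          ≡⟨ cong sum (map-cong (λ i → visits-period (f i) q r) (allFin a)) ⟩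
  sum (map (λ i → q + visits (f i) r) (allFin a))  ≡⟨ sum-map-+ (λ _ → q) _ (allFin a) ⟩
  sum (map (λ _ → q) (allFin a)) + total f r       ≡⟨ cong (_+ total f r) (sum-const-allFin {a} q) ⟩
  a * q + total f r                                ∎
  where open ≡-Reasoning

div-mod : ∀ x n → x ≡ (x / suc n) * suc n + x % suc n
div-mod x n = trans (m≡m%n+[m/n]*n x (suc n)) (+-comm (x % suc n) _)

-- A period adds `a` to `total`, hence `suc n * a` to both sides of the inequality, so the first
-- period decides.
ballot-period : (f : Fin a → Fin (suc n)) →
                (∀ {x} → x ≤ suc n → a * x ≤ suc n * total f x) → Ballot f
ballot-period {a} {n} f D x = subst (λ x → a * x ≤ suc n * total f x) (sym (div-mod x n)) $ begin
  a * (q * suc n + r)                  ≡⟨ rearrange a q (suc n) r ⟩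
  suc n * (a * q) + a * r              ≤⟨ +-monoʳ-≤ _ (D (<⇒≤ (m%n<n x (suc n)))) ⟩
  suc n * (a * q) + suc n * total f r  ≡⟨ *-distribˡ-+ (suc n) (a * q) _ ⟨
  suc n * (a * q + total f r)          ≡⟨ cong (suc n *_) (total-period f q r) ⟨
  suc n * total f (q * suc n + r)      ∎
  where
  open ≤-Reasoning
  q = x / suc n
  r = x % suc n
  rearrange : ∀ a q b r → a * (q * b + r) ≡ b * (a * q) + a * r
  rearrange = solve-∀

-- The height b · total f x − a · x is 0 at x = y · suc n. It is nonnegative at y, and from
-- there on never below its value at y; so it is 0 at y.
ballot-shift-unique : Coprime a (suc n) → (f : Fin a → Fin (suc n)) (y : ℕ) →
                      Ballot f → Ballot (λ i → f i ⊖ y) → suc n ∣ y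
ballot-shift-unique {a} {n} cop f y D D′ =
  -- Height 0 at `y` says that `suc n * T` equals `a * y`; coprimality then cancels the factor `a`.
  coprime-divisor (coprime-sym cop) (divides T (trans (≤-antisym (D y) bT≤ay) (*-comm b T)))
  where
  b = suc n
  T = total f y
  T′ = total (λ i → f i ⊖ y) (y * n)
  T+T′ : T + T′ ≡ a * y
  T+T′ = begin
    T + T′                ≡⟨ total-+ f y (y * n) ⟨
    total f (y + y * n)   ≡⟨ cong (total f) (trans (sym (*-suc y n)) (sym (+-identityʳ _))) ⟩
    total f (y * b + 0)   ≡⟨ total-period f y 0 ⟩
    a * y + total f 0     ≡⟨ cong (a * y +_) (trans (sum-const-allFin {a} 0) (*-zeroʳ a)) ⟩
    a * y + 0             ≡⟨ +-identityʳ _ ⟩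
    a * y                 ∎
    where open ≡-Reasoning
  expand : ∀ a y n → suc n * (a * y) ≡ a * y + a * (y * n)
  expand = solve-∀
  bT≤ay : b * T ≤ a * y
  bT≤ay = +-cancelʳ-≤ (a * (y * n)) _ _ $ begin
    b * T + a * (y * n)   ≤⟨ +-monoʳ-≤ (b * T) (D′ (y * n)) ⟩
    b * T + b * T′        ≡⟨ *-distribˡ-+ b T T′ ⟨
    b * (T + T′)          ≡⟨ cong (b *_) T+T′ ⟩
    b * (a * y)           ≡⟨ expand a y n ⟩
    a * y + a * (y * n)   ∎
    where open ≤-Reasoning

-- The lowest height gives a ballot shift.

module _ {a n} (f : Fin a → Fin (suc n)) where

  private
    b : ℕ
    b = suc n

    -- The height b · total f x − a · x, raised by a · b to avoid truncated subtraction.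
    height : ℕ → ℕ
    height x = b * total f x + a * (b ∸ x)

    -- Adding `a * b` lets the truncated `b ∸ x` recombine with `x`; this turns inequalities between
    -- raised heights into ones without subtraction.
    height-+ : ∀ {x} z → x ≤ b → b * total f x + a * z + a * b ≡ height x + a * (x + z)
    height-+ {x} z x≤b = begin
      b * total f x + a * z + a * b            ≡⟨ cong (λ d → b * total f x + a * z + a * d) (m∸n+n≡m x≤b) ⟨
      b * total f x + a * z + a * (b ∸ x + x)  ≡⟨ rearrange (b * total f x) a z (b ∸ x) x ⟩
      height x + a * (x + z)                   ∎
      where
      open ≡-Reasoning
      rearrange : ∀ t a z d x → t + a * z + a * (d + x) ≡ (t + a * d) + a * (x + z)
      rearrange = solve-∀

    module _ {y : ℕ} (y<b : y < b) (lowest : ∀ {x} → x < b → height y ≤ height x) where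

      lowest-in-period : ∀ {x} → x < b → b * total f y + a * x ≤ b * total f x + a * y
      lowest-in-period {x} x<b = +-cancelʳ-≤ (a * b) _ _ $ begin
        b * total f y + a * x + a * b  ≡⟨ height-+ x (<⇒≤ y<b) ⟩
        height y + a * (y + x)         ≤⟨ +-monoˡ-≤ (a * (y + x)) (lowest x<b) ⟩
        height x + a * (y + x)         ≡⟨ cong (λ z → height x + a * z) (+-comm y x) ⟩
        height x + a * (x + y)         ≡⟨ height-+ y (<⇒≤ x<b) ⟨
        b * total f x + a * y + a * b  ∎
        where open ≤-Reasoning

      -- Reducing `y + x` modulo `b` leaves the height unchanged, so a minimum over one period is a
      -- minimum over all that lies ahead.
      lowest-ahead : ∀ x → b * total f y + a * x ≤ b * total f (y + x)
      lowest-ahead x = +-cancelʳ-≤ (a * y) _ _ $ begin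
        b * total f y + a * x + a * y          ≡⟨ regroup₁ (b * total f y) a x y ⟩
        b * total f y + a * (y + x)            ≡⟨ cong (λ z → b * total f y + a * z) (div-mod (y + x) n) ⟩
        b * total f y + a * (q * b + r)        ≡⟨ regroup₂ (b * total f y) a q b r ⟩
        b * (a * q) + (b * total f y + a * r)  ≤⟨ +-monoʳ-≤ (b * (a * q)) (lowest-in-period (m%n<n (y + x) b)) ⟩
        b * (a * q) + (b * total f r + a * y)  ≡⟨ regroup₃ b (a * q) (total f r) (a * y) ⟩
        b * (a * q + total f r) + a * y        ≡⟨ cong (λ t → b * t + a * y) (total-period f q r) ⟨
        b * total f (q * b + r) + a * y        ≡⟨ cong (λ z → b * total f z + a * y) (div-mod (y + x) n) ⟨
        b * total f (y + x) + a * y            ∎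
        where
        open ≤-Reasoning
        q = (y + x) / b
        r = (y + x) % b
        regroup₁ : ∀ t a x y → t + a * x + a * y ≡ t + a * (y + x)
        regroup₁ = solve-∀
        regroup₂ : ∀ t a q b r → t + a * (q * b + r) ≡ b * (a * q) + (t + a * r)
        regroup₂ = solve-∀
        regroup₃ : ∀ b s t u → b * s + (b * t + u) ≡ b * (s + t) + u
        regroup₃ = solve-∀

      -- The height of the shifted function at `x` is the height of `f` at `y + x` minus that at
      -- `y`.
      lowest⇒ballot : Ballot (λ i → f i ⊖ y)
      lowest⇒ballot x = +-cancelˡ-≤ (b * total f y) _ _ $ begin
        b * total f y + a * x                        ≤⟨ lowest-ahead x ⟩
        b * total f (y + x)                          ≡⟨ cong (b *_) (total-+ f y x) ⟩
        b * (total f y + total (λ i → f i ⊖ y) x)    ≡⟨ *-distribˡ-+ b (total f y) _ ⟩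
        b * total f y + b * total (λ i → f i ⊖ y) x  ∎
        where open ≤-Reasoning

  abstract
    ballot-shift-exists : ∃ λ y → Ballot (λ i → f i ⊖ y)
    ballot-shift-exists =
      -- The starting value `0` of `argmin` lies in the period itself, so the minimum stays below
      -- `b`.
      argmin height 0 (upTo b) ,
      lowest⇒ballot
        (argmin-all height {P = _< b} z<s (All.tabulate ∈-upTo⁻))
        (λ x<b → All.lookup (f[argmin]≤f[xs] {f = height} 0 (upTo b)) (∈-upTo⁺ x<b))

-- Counting ballot functions through translation classes.

mkInverse : ∀ {s₁ s₂ t₁ t₂} {S : Setoid s₁ s₂} {T : Setoid t₁ t₂} →
            let open Setoid S using () renaming (Carrier to X; _≈_ to _≈₁_)
                open Setoid T using () renaming (Carrier to Y; _≈_ to _≈₂_) in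
            (to : X → Y) (from : Y → X) →
            (∀ {x x′} → x ≈₁ x′ → to x ≈₂ to x′) → (∀ {y y′} → y ≈₂ y′ → from y ≈₁ from y′) →
            (∀ y → to (from y) ≈₂ y) → (∀ x → from (to x) ≈₁ x) → Inverse S T
mkInverse {S = S} {T = T} to from to-cong from-cong to∘from from∘to = record
  { to = to ; from = from ; to-cong = to-cong ; from-cong = from-cong
  ; inverse = (λ eq → Setoid.trans T (to-cong eq) (to∘from _))
            , (λ eq → Setoid.trans S (from-cong eq) (from∘to _)) }

funToFin-cong : ∀ {m k} {f g : Fin k → Fin m} → f ≗ g → funToFin f ≡ funToFin g
funToFin-cong {k = zero}  f≗g = refl
funToFin-cong {k = suc k} f≗g = cong₂ combine (f≗g zero) (funToFin-cong (f≗g ∘ suc))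

-- Ballot functions factoring through `c`, given by the factor `g`. With `c` the identity these
-- stand for all parking functions, with `c` the class map of `Cycles w` for those fixed by `w`, so
-- one count serves both.
BallotVia : {a k : ℕ} (n : ℕ) → (Fin a → Fin k) → Setoid 0ℓ 0ℓ
BallotVia {k = k} n c =
  On.setoid {B = ∃ λ (g : Fin k → Fin (suc n)) → Ballot (g ∘ c)}
    (Fin k →-setoid Fin (suc n)) proj₁

module _ (cop : Coprime a (suc n)) (c : Fin a → Fin (suc k)) where

  private
    -- A complete invariant of `g` up to translation.
    differences : (Fin (suc k) → Fin (suc n)) → Fin k → Fin (suc n)
    differences g j = g (suc j) ⊖ toℕ (g zero)

    -- The representative of a translation class with value `zero` at index `zero`; `offset` then
    -- moves it to a ballot function.
    cons : (Fin k → Fin (suc n)) → Fin (suc k) → Fin (suc n)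
    cons h zero    = zero
    cons h (suc j) = h j

    offset : (Fin k → Fin (suc n)) → ℕ
    offset h = proj₁ (ballot-shift-exists (cons h ∘ c))

    undifference : (Fin k → Fin (suc n)) → Fin (suc k) → Fin (suc n)
    undifference h j = cons h j ⊖ offset h

    -- Shifting by the offset `y` and then by the value `z` reached at index `zero` brings `zero`
    -- back to `zero`, so the combined shift is the identity.
    differences-undifference : ∀ h → differences (undifference h) ≗ h
    differences-undifference h j =
      trans (sym (⊖-+ (h j) y z))
            (zero-fixed⇒fixed {y = y + z} (trans (⊖-+ zero y z) (v⊖v≡0 (zero ⊖ y))) (h j))
      where
      y = offset h
      z = toℕ (zero ⊖ y)

    -- `undifference h` is a translate of `g`, and both are ballot along `c`, so the shift between
    -- them is a multiple of the period. Pointwise equality of `h` with `differences g` is assumed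
    -- because `h` comes from decoding an element of a finite type.
    undifference-differences : ∀ g h → Ballot (g ∘ c) → h ≗ differences g → undifference h ≗ g
    undifference-differences g h D h≗ j = trans (shifted j) (fixed b∣y)
      where
      y = toℕ (g zero) + offset h
      cons-h : ∀ j → cons h j ≡ g j ⊖ toℕ (g zero)
      cons-h zero    = sym (v⊖v≡0 (g zero))
      cons-h (suc j) = h≗ j
      shifted : ∀ j → undifference h j ≡ g j ⊖ y
      shifted j = trans (cong (_⊖ offset h) (cons-h j)) (sym (⊖-+ (g j) (toℕ (g zero)) _))
      b∣y : suc n ∣ y
      b∣y = ballot-shift-unique cop (g ∘ c) y D
              (Ballot-resp-≗ (shifted ∘ c) (proj₂ (ballot-shift-exists (cons h ∘ c))))
      fixed : suc n ∣ y → g j ⊖ y ≡ g j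
      fixed (divides q eq) = trans (cong (g j ⊖_) eq) (⊖-period (g j) q)

  BallotVia-size : BallotVia n c HasSize (suc n ^ k)
  BallotVia-size = mkInverse
    (λ (g , _) → funToFin (differences g))
    (λ e → let h = finToFun e in undifference h , proj₂ (ballot-shift-exists (cons h ∘ c)))
    (λ g≗g′ → funToFin-cong (λ j → cong₂ (λ v u → v ⊖ toℕ u) (g≗g′ (suc j)) (g≗g′ zero)))
    (λ { refl _ → refl })
    (λ e → trans (funToFin-cong (differences-undifference (finToFun e))) (funToFin-finToFin {k} e))
    (λ (g , D) → undifference-differences g _ D (finToFun-funToFin (differences g)))

-- Labelled paths and the columns of their labels.

#north-shape : (p : List (Step L)) → #north (shape p) ≡ #north p
#north-shape []            = refl
#north-shape (north _ ∷ p) = cong suc (#north-shape p)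
#north-shape (east ∷ p)    = #north-shape p

#east-shape : (p : List (Step L)) → #east (shape p) ≡ #east p
#east-shape []            = refl
#east-shape (north _ ∷ p) = #east-shape p
#east-shape (east ∷ p)    = cong suc (#east-shape p)

#north≡length-labels : (p : List (Step L)) → #north p ≡ length (labels p)
#north≡length-labels []            = refl
#north≡length-labels (north _ ∷ p) = cong suc (#north≡length-labels p)
#north≡length-labels (east ∷ p)    = #north≡length-labels p

-- A relation, since in an arbitrary path a label may lie in several columns or in none.
data Column {L : Set} (l : L) : ℕ → List (Step L) → Set where
  here  : ∀ {p} → Column l 0 (north l ∷ p)
  north : ∀ {x m p} → Column l x p → Column l x (north m ∷ p)
  east  : ∀ {x p} → Column l x p → Column l (suc x) (east ∷ p)

Column⇒∈ : ∀ {l : L} {x p} → Column l x p → l ∈ labels p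
Column⇒∈ here      = Any.here refl
Column⇒∈ (north c) = Any.there (Column⇒∈ c)
Column⇒∈ (east c)  = Column⇒∈ c

∈⇒Column : ∀ {l : L} p → l ∈ labels p → ∃ λ x → Column l x p
∈⇒Column (north m ∷ p) (Any.here refl) = 0 , here
∈⇒Column (north m ∷ p) (Any.there l∈)  = let x , c = ∈⇒Column p l∈ in x , north c
∈⇒Column (east ∷ p)    l∈              = let x , c = ∈⇒Column p l∈ in suc x , east c

Column-unique : ∀ {l : L} {x y p} → Unique (labels p) → Column l x p → Column l y p → x ≡ y
Column-unique u        here      here      = refl
Column-unique (l∉ ∷ u) here      (north d) = ⊥-elim (All.lookup l∉ (Column⇒∈ d) refl)
Column-unique (l∉ ∷ u) (north c) here      = ⊥-elim (All.lookup l∉ (Column⇒∈ c) refl)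
Column-unique (l∉ ∷ u) (north c) (north d) = Column-unique u c d
Column-unique u        (east c)  (east d)  = cong suc (Column-unique u c d)

Column-relabel : ∀ {l : L} {x p} (f : L → M) → Column l x p → Column (f l) x (relabel f p)
Column-relabel f here      = here
Column-relabel f (north c) = north (Column-relabel f c)
Column-relabel f (east c)  = east (Column-relabel f c)

Column-insert : ∀ {i j : Fin a} {x} p → Column i x (north j ∷ p) → Column i x (insert j p)
Column-insert         []            c = c
Column-insert         (east ∷ p)    c = c
Column-insert {j = j} (north m ∷ p) c with j Fin.≤? m
Column-insert {j = j} (north m ∷ p) c                 | yes _ = c
Column-insert {j = j} (north m ∷ p) here              | no  _ = north (Column-insert p here)
Column-insert {j = j} (north m ∷ p) (north here)      | no  _ = here
Column-insert {j = j} (north m ∷ p) (north (north c)) | no  _ = north (Column-insert p (north c))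

Column-sortColumns : ∀ {i : Fin a} {x p} → Column i x p → Column i x (sortColumns p)
Column-sortColumns {p = north _ ∷ p} here      = Column-insert (sortColumns p) here
Column-sortColumns {p = north _ ∷ p} (north c) = Column-insert (sortColumns p) (north (Column-sortColumns c))
Column-sortColumns {p = east ∷ p}    (east c)  = east (Column-sortColumns c)

increasing-< : ∀ {i j : Fin a} {p} → Linked _⊏_ (north j ∷ p) → Column i 0 p → j Fin.< i
increasing-< (j<i ∷ l) here      = j<i
increasing-< (j<m ∷ l) (north c) = Fin.<-trans j<m (increasing-< l c)

private
  first-column-≤ : ∀ {i j : Fin a} {p} → Linked _⊏_ (north j ∷ p) → Column i 0 (north j ∷ p) → j Fin.≤ i
  first-column-≤ l here      = ≤-refl
  first-column-≤ l (north c) = <⇒≤ (increasing-< l c)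

  drop-first : ∀ {i j : Fin a} {x p q} → Linked _⊏_ (north j ∷ p) →
               Column i x p → Column i x (north j ∷ q) → Column i x q
  drop-first l c here      = ⊥-elim (Fin.<-irrefl refl (increasing-< l c))
  drop-first l c (north d) = d

  drop-east : ∀ {l : L} {x p} → Column l (suc x) (east ∷ p) → Column l x p
  drop-east (east c) = c

-- Induction on both paths. The first label of column 0 is its least, so two initial north steps
-- agree. A north step facing an east step or the empty path would give a label in column 0 that the
-- other path lacks. The count of east steps rules out an east step facing the empty path.
increasing-≡ : {p q : List (Step (Fin a))} → Linked _⊏_ p → Linked _⊏_ q → #east p ≡ #east q →
               (∀ {i x} → Column i x p → Column i x q) → (∀ {i x} → Column i x q → Column i x p) →
               p ≡ q
increasing-≡ {p = []}          {[]}          _  _  _  _ _ = refl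
increasing-≡ {p = []}          {north _ ∷ _} _  _  _  _ g with () ← g here
increasing-≡ {p = east ∷ _}    {north _ ∷ _} _  _  _  _ g with () ← g here
increasing-≡ {p = north _ ∷ _} {[]}          _  _  _  f _ with () ← f here
increasing-≡ {p = north _ ∷ _} {east ∷ _}    _  _  _  f _ with () ← f here
increasing-≡ {p = east ∷ _}    {east ∷ _}    lp lq eq f g =
  cong (east ∷_) (increasing-≡ (tail lp) (tail lq) (suc-injective eq)
                    (drop-east ∘ f ∘ east) (drop-east ∘ g ∘ east))
increasing-≡ {p = north i ∷ _} {north j ∷ _} lp lq eq f g
  with refl ← Fin.≤-antisym (first-column-≤ lp (g here)) (first-column-≤ lq (f here)) =
  cong (north i ∷_) (increasing-≡ (tail lp) (tail lq) eq
                       (λ c → drop-first lp c (f (north c))) (λ c → drop-first lq c (g (north c))))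

-- Heights of a path as counts of labels.

-- For `x` at most the number of east steps, this is the height of the lowest vertex with abscissa
-- `x`, where the Dyck condition is tightest.
#northBefore : ℕ → List (Step L) → ℕ
#northBefore zero    p             = 0
#northBefore (suc x) []            = 0
#northBefore (suc x) (north _ ∷ p) = suc (#northBefore (suc x) p)
#northBefore (suc x) (east ∷ p)    = #northBefore x p

#northBefore-shape : ∀ x (p : List (Step L)) → #northBefore x (shape p) ≡ #northBefore x p
#northBefore-shape zero    p             = refl
#northBefore-shape (suc x) []            = refl
#northBefore-shape (suc x) (north _ ∷ p) = cong suc (#northBefore-shape (suc x) p)
#northBefore-shape (suc x) (east ∷ p)    = #northBefore-shape x p

-- The end of the prefix `p` may lie above the lowest vertex with its abscissa; this reduces the
-- Dyck condition at all vertices to the lowest ones.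
#northBefore-≤ : (p q : List (Step L)) → #northBefore (#east p) (p ++ q) ≤ #north p
#northBefore-≤ []            q = z≤n
#northBefore-≤ (east ∷ p)    q = #northBefore-≤ p q
#northBefore-≤ (north l ∷ p) q with #east p | #northBefore-≤ p q
... | zero  | _  = z≤n
... | suc _ | le = s≤s le

-- The prefix stops right after the `x`-th east step, or is empty for `x = 0`; the Dyck condition
-- can thus be read off at a lowest vertex.
#northBefore-split : ∀ x (p : List (Step L)) → x ≤ #east p →
                     ∃₂ λ q r → p ≡ q ++ r × #east q ≡ x × #north q ≡ #northBefore x p
#northBefore-split zero    p             _   = [] , p , refl , refl , refl
#northBefore-split (suc x) (north l ∷ p) x≤p =
  let q , r , p≡ , e , n = #northBefore-split (suc x) p x≤p
  in north l ∷ q , r , cong (north l ∷_) p≡ , e , cong suc n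
#northBefore-split (suc x) (east ∷ p) (s≤s x≤p) =
  let q , r , p≡ , e , n = #northBefore-split x p x≤p
  in east ∷ q , r , cong (east ∷_) p≡ , cong suc e , n

Column-split : ∀ {l : L} {x p} → Column l x p → ∃₂ λ q r → p ≡ q ++ north l ∷ r × #east q ≡ x
Column-split {p = north l ∷ p} here      = [] , p , refl , refl
Column-split {p = north m ∷ _} (north c) =
  let q , r , p≡ , e = Column-split c in north m ∷ q , r , cong (north m ∷_) p≡ , e
Column-split                   (east c)  =
  let q , r , p≡ , e = Column-split c in east ∷ q , r , cong (east ∷_) p≡ , cong suc e

#north-++ : (p : List (Step L)) {l : L} (q : List (Step L)) → #north p < #north (p ++ north l ∷ q)
#north-++ []            q = z<s
#north-++ (north _ ∷ p) q = s<s (#north-++ p q)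
#north-++ (east ∷ p)    q = #north-++ p q

#east-++ : (p q : List (Step L)) → #east p ≤ #east (p ++ q)
#east-++ []            q = z≤n
#east-++ (north _ ∷ p) q = #east-++ p q
#east-++ (east ∷ p)    q = s≤s (#east-++ p q)

#northBefore-sum : ∀ x (p : List (Step L)) (u : L → ℕ) →
                   (∀ {l y} → Column l y p → u l ≡ below y x) →
                   #northBefore x p ≡ sum (map u (labels p))
#northBefore-sum x       []            u h with x
... | zero  = refl
... | suc _ = refl
#northBefore-sum zero    (north l ∷ p) u h = cong₂ _+_ (sym (h here)) (#northBefore-sum 0 p u (h ∘ north))
#northBefore-sum (suc x) (north l ∷ p) u h = cong₂ _+_ (sym (h here)) (#northBefore-sum (suc x) p u (h ∘ north))
#northBefore-sum zero    (east ∷ p)    u h = #northBefore-sum 0 p u (h ∘ east)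
#northBefore-sum (suc x) (east ∷ p)    u h = #northBefore-sum x p u (h ∘ east)

#northBefore-total : {p : List (Step (Fin a))} (f : Fin a → Fin (suc n)) → labels p ↭ allFin a →
                     (∀ {i y} → Column i y p → toℕ (f i) ≡ y) →
                     ∀ {x} → x ≤ suc n → #northBefore x p ≡ total f x
#northBefore-total {p = p} f ls h {x} x≤ =
  trans (#northBefore-sum x p (λ i → visits (f i) x)
           (λ {i} c → trans (visits≡below (f i) x≤) (cong (λ y → below y x) (h c))))
        (sum-↭ (map⁺ (λ i → visits (f i) x) ls))

-- The column function of a parking function.

module _ (P : ParkingFunction a n) where

  labels-unique : Unique (labels (path P))
  labels-unique = bijective⇒unique (bijective P)

  labels-complete : (i : Fin a) → i ∈ labels (path P)
  labels-complete = bijective⇒∈ (bijective P)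

  -- Two duplicate-free lists with the same elements are permutations of each other.
  labels-↭ : labels (path P) ↭ allFin a
  labels-↭ = ∼bag⇒↭ (unique∧set⇒bag labels-unique (allFin⁺ a)
                       (mk⇔ (λ _ → ∈-allFin _) (λ _ → labels-complete _)))

  #east-path : #east (path P) ≡ n
  #east-path = trans (sym (#east-shape (path P))) (easts (dyck P))

-- A north step leaves a vertex of height less than `a`, and the Dyck condition there forces its
-- abscissa below `suc n`: no label lies on the final vertical line.
Column-< : (P : ParkingFunction a (suc n)) → ∀ {i x} → Column i x (path P) → x < suc n
Column-< {a} {n} P {x = x} c =
  let q , r , p≡ , e = Column-split (Column-relabel (λ _ → tt) c)
      open ≤-Reasoning
  in *-cancelˡ-< a x (suc n) $ begin-strict
    a * x                               ≡⟨ cong (a *_) e ⟨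
    a * #east q                         ≤⟨ above (dyck P) q _ p≡ ⟩
    suc n * #north q                    <⟨ *-monoʳ-< (suc n) (#north-++ q r) ⟩
    suc n * #north (q ++ north tt ∷ r)  ≡⟨ cong (suc n *_) (trans (cong #north (sym p≡)) (norths (dyck P))) ⟩
    suc n * a                           ≡⟨ *-comm (suc n) a ⟩
    a * suc n                           ∎

column : ParkingFunction a (suc n) → Fin a → Fin (suc n)
column P i = fromℕ< (Column-< P (proj₂ (∈⇒Column (path P) (labels-complete P i))))

Column-column : (P : ParkingFunction a (suc n)) (i : Fin a) → Column i (toℕ (column P i)) (path P)
Column-column P i =
  subst (λ x → Column i x (path P)) (sym (Fin.toℕ-fromℕ< (Column-< P c))) c
  where c = proj₂ (∈⇒Column (path P) (labels-complete P i))

Column⇒column : (P : ParkingFunction a (suc n)) {i : Fin a} {x : ℕ} → Column i x (path P) → toℕ (column P i) ≡ x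
Column⇒column P {i} = Column-unique (labels-unique P) (Column-column P i)

column-cong : (P Q : ParkingFunction a (suc n)) → path P ≡ path Q → column P ≗ column Q
column-cong P Q eq i = Fin.toℕ-injective (Column⇒column P (subst (Column i _) (sym eq) (Column-column Q i)))

column-injective : (P Q : ParkingFunction a (suc n)) → column P ≗ column Q → path P ≡ path Q
column-injective P Q eq =
  increasing-≡ (increasing P) (increasing Q) (trans (#east-path P) (sym (#east-path Q)))
    (transport P Q eq) (transport Q P (sym ∘ eq))
  where
  transport : ∀ P Q → column P ≗ column Q → ∀ {i x} → Column i x (path P) → Column i x (path Q)
  transport P Q eq {i} c =
    subst (λ x → Column i x (path Q)) (trans (cong toℕ (sym (eq i))) (Column⇒column P c)) (Column-column Q i)

-- Relabelling puts `w ⟨$⟩ʳ i` where `i` was, and sorting moves labels within their columns only.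
column-act : (w : Permutation′ a) (P : ParkingFunction a (suc n)) (i : Fin a) →
             column (act w P) (w ⟨$⟩ʳ i) ≡ column P i
column-act w P i = Fin.toℕ-injective $ Column⇒column (act w P) $
  Column-sortColumns (Column-relabel (w ⟨$⟩ʳ_) (Column-column P i))

-- The Dyck condition at the lowest vertex of each abscissa gives the first period, and
-- `ballot-period` the rest.
column-ballot : (P : ParkingFunction a (suc n)) → Ballot (column P)
column-ballot {a} {n} P = ballot-period (column P) λ {x} x≤b →
  let p = shape (path P)
      q , r , p≡ , e , m = #northBefore-split x p (subst (x ≤_) (sym (easts (dyck P))) x≤b)
      #q = trans m (trans (#northBefore-shape x (path P))
                          (#northBefore-total (column P) (labels-↭ P) (Column⇒column P) x≤b))
  in subst₂ (λ x m → a * x ≤ suc n * m) e #q (above (dyck P) q r p≡)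

-- Building a parking function from a ballot function.

-- Junk when x > #east p: the new step is then put at the end.
place : ℕ → Fin a → List (Step (Fin a)) → List (Step (Fin a))
place zero    i p             = north i ∷ p
place (suc x) i []            = north i ∷ []
place (suc x) i (north j ∷ p) = north j ∷ place (suc x) i p
place (suc x) i (east ∷ p)    = east ∷ place x i p

#east-place : ∀ x (i : Fin a) p → #east (place x i p) ≡ #east p
#east-place zero    i p             = refl
#east-place (suc x) i []            = refl
#east-place (suc x) i (north j ∷ p) = #east-place (suc x) i p
#east-place (suc x) i (east ∷ p)    = cong suc (#east-place x i p)

labels-place : ∀ x (i : Fin a) p → labels (place x i p) ↭ i ∷ labels p
labels-place zero    i p             = ↭-refl
labels-place (suc x) i []            = ↭-refl
labels-place (suc x) i (north j ∷ p) = ↭-trans (prep j (labels-place (suc x) i p)) (swap j i ↭-refl)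
labels-place (suc x) i (east ∷ p)    = labels-place x i p

Column-place-new : ∀ {x} (i : Fin a) p → x ≤ #east p → Column i x (place x i p)
Column-place-new {x = zero}  i p             _        = here
Column-place-new {x = suc x} i (north j ∷ p) x≤       = north (Column-place-new i p x≤)
Column-place-new {x = suc x} i (east ∷ p)    (s≤s x≤) = east (Column-place-new i p x≤)

Column-place-old : ∀ x {i j : Fin a} {y p} → Column j y p → Column j y (place x i p)
Column-place-old zero    c         = north c
Column-place-old (suc x) here      = here
Column-place-old (suc x) (north c) = north (Column-place-old (suc x) c)
Column-place-old (suc x) (east c)  = east (Column-place-old x c)

module _ (f : Fin a → Fin n) where

  placeAll : List (Fin a) → List (Step (Fin a))
  placeAll = foldr (λ i → place (toℕ (f i)) i) (replicate n east)

  #east-placeAll : ∀ is → #east (placeAll is) ≡ n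
  #east-placeAll []       = #east-replicate n
    where
    #east-replicate : ∀ m → #east {L = Fin a} (replicate m east) ≡ m
    #east-replicate zero    = refl
    #east-replicate (suc m) = cong suc (#east-replicate m)
  #east-placeAll (i ∷ is) = trans (#east-place (toℕ (f i)) i (placeAll is)) (#east-placeAll is)

  labels-placeAll : ∀ is → labels (placeAll is) ↭ is
  labels-placeAll []       = subst (_↭ []) (sym (labels-replicate n)) ↭-refl
    where
    labels-replicate : ∀ m → labels {L = Fin a} (replicate m east) ≡ []
    labels-replicate zero    = refl
    labels-replicate (suc m) = labels-replicate m
  labels-placeAll (i ∷ is) =
    ↭-trans (labels-place (toℕ (f i)) i (placeAll is)) (prep i (labels-placeAll is))

  Column-placeAll : ∀ {i is} → i ∈ is → Column i (toℕ (f i)) (placeAll is)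
  Column-placeAll {is = i ∷ is} (Any.here refl) =
    Column-place-new i (placeAll is) (subst (toℕ (f i) ≤_) (sym (#east-placeAll is)) (<⇒≤ (Fin.toℕ<n (f i))))
  Column-placeAll {is = j ∷ is} (Any.there i∈) = Column-place-old (toℕ (f j)) (Column-placeAll i∈)

module _ (f : Fin a → Fin (suc n)) (D : Ballot f) where

  private
    p : List (Step (Fin a))
    -- Sorting makes the columns increase whatever the order of insertion, and moves no label to
    -- another column.
    p = sortColumns (placeAll f (allFin a))

    labels-p : labels p ↭ allFin a
    labels-p = ↭-trans (labels-sortColumns (placeAll f (allFin a))) (labels-placeAll f (allFin a))

    unique : Unique (labels p)
    unique = Unique-resp-↭ (↭-sym labels-p) (allFin⁺ a)

    Column-p : ∀ i → Column i (toℕ (f i)) p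
    Column-p i = Column-sortColumns (Column-placeAll f (∈-allFin i))

    #east-p : #east (shape p) ≡ suc n
    #east-p = trans (cong #east (shape-sortColumns (placeAll f (allFin a))))
                (trans (#east-shape (placeAll f (allFin a))) (#east-placeAll f (allFin a)))

    #north-p : #north (shape p) ≡ a
    #north-p = trans (#north-shape p) (trans (#north≡length-labels p)
                 (trans (↭-length labels-p) (length-tabulate {n = a} id)))

    above-p : ∀ q r → shape p ≡ q ++ r → a * #east q ≤ suc n * #north q
    above-p q r p≡ = begin
      a * #east q                               ≤⟨ D (#east q) ⟩
      suc n * total f (#east q)                 ≡⟨ cong (suc n *_) total-f ⟨
      suc n * #northBefore (#east q) p          ≡⟨ cong (suc n *_) (#northBefore-shape (#east q) p) ⟨
      suc n * #northBefore (#east q) (shape p)  ≡⟨ cong (λ p → suc n * #northBefore (#east q) p) p≡ ⟩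
      suc n * #northBefore (#east q) (q ++ r)   ≤⟨ *-monoʳ-≤ (suc n) (#northBefore-≤ q r) ⟩
      suc n * #north q                          ∎
      where
      open ≤-Reasoning
      q≤b : #east q ≤ suc n
      q≤b = subst (#east q ≤_) (trans (cong #east (sym p≡)) #east-p) (#east-++ q r)
      total-f : #northBefore (#east q) p ≡ total f (#east q)
      total-f = #northBefore-total f labels-p (λ {i} → Column-unique unique (Column-p i)) q≤b

  fromColumns : ParkingFunction a (suc n)
  fromColumns = record
    { path       = p
    ; dyck       = record { norths = #north-p ; easts = #east-p ; above = above-p }
    ; bijective  = unique∧∈⇒bijective unique (λ i → ∈-resp-↭ (↭-sym labels-p) (∈-allFin i))
    ; increasing = sortColumns-increasing (placeAll f (allFin a))
                     (Unique-resp-↭ (↭-sym (labels-placeAll f (allFin a))) (allFin⁺ a))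
    }

  column-fromColumns : column fromColumns ≗ f
  column-fromColumns i = Fin.toℕ-injective (Column⇒column fromColumns (Column-p i))

-- Fixed parking functions and the final counts.

fixed⇒invariant : (w : Permutation′ a) (P : ParkingFunction a (suc n)) →
                  path (act w P) ≡ path P → ∀ i → column P (w ⟨$⟩ʳ i) ≡ column P i
fixed⇒invariant w P fixed i =
  trans (sym (column-cong (act w P) P fixed (w ⟨$⟩ʳ i))) (column-act w P i)

-- Columns determine the path, so comparing columns suffices; writing each label as the image under
-- `w` of its preimage makes `column-act` applicable.
invariant⇒fixed : (w : Permutation′ a) (P : ParkingFunction a (suc n)) →
                  (∀ i → column P (w ⟨$⟩ʳ i) ≡ column P i) → path (act w P) ≡ path P
invariant⇒fixed w P inv = column-injective (act w P) P λ i → begin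
  column (act w P) i                      ≡⟨ cong (column (act w P)) (inverseʳ w) ⟨
  column (act w P) (w ⟨$⟩ʳ (w ⟨$⟩ˡ i))    ≡⟨ column-act w P (w ⟨$⟩ˡ i) ⟩
  column P (w ⟨$⟩ˡ i)                     ≡⟨ inv (w ⟨$⟩ˡ i) ⟨
  column P (w ⟨$⟩ʳ (w ⟨$⟩ˡ i))            ≡⟨ cong (column P) (inverseʳ w) ⟩
  column P i                              ∎
  where open ≡-Reasoning

fromColumns-cong : {f g : Fin a → Fin (suc n)} (D : Ballot f) (E : Ballot g) → f ≗ g →
                   path (fromColumns f D) ≡ path (fromColumns g E)
fromColumns-cong {f = f} {g} D E f≗g = column-injective (fromColumns f D) (fromColumns g E) λ i →
  trans (column-fromColumns f D i) (trans (f≗g i) (sym (column-fromColumns g E i)))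

fromColumns-column : (P : ParkingFunction a (suc n)) {f : Fin a → Fin (suc n)} (D : Ballot f) →
                     f ≗ column P → path (fromColumns f D) ≡ path P
fromColumns-column P {f} D f≗ =
  column-injective (fromColumns f D) P (λ i → trans (column-fromColumns f D i) (f≗ i))

-- The case where `c` is the identity, which yields the exponent `a ∸ 1`.
PF↔Ballot : Inverse (PF a (suc n)) (BallotVia n id)
PF↔Ballot = mkInverse
  (λ P → column P , column-ballot P)
  (λ (f , D) → fromColumns f D)
  (λ {P} {Q} → column-cong P Q)
  (λ {(_ , D)} {(_ , E)} → fromColumns-cong D E)
  (λ (f , D) → column-fromColumns f D)
  (λ P → fromColumns-column P (column-ballot P) (λ _ → refl))

module _ (w : Permutation′ a) (cycles : Cycles w HasSize k) where

  private
    module C = Inverse cycles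

    -- Invariance along the generators `i ~ w i` extends to the generated equivalence, and
    -- `C.from (C.to i)` lies on the cycle of `i`.
    cycle-constant : (P : ParkingFunction a (suc n)) → path (act w P) ≡ path P →
                     column P ∘ C.from ∘ C.to ≗ column P
    cycle-constant P fixed i =
      EqClosure.gfold isEquivalence (column P)
        (λ {i} wi≡j → trans (sym (fixed⇒invariant w P fixed i)) (cong (column P) wi≡j))
        (C.strictlyInverseʳ i)

    ballot-on-cycles : (P : ParkingFunction a (suc n)) → path (act w P) ≡ path P →
                       Ballot (column P ∘ C.from ∘ C.to)
    ballot-on-cycles P fixed = Ballot-resp-≗ (sym ∘ cycle-constant P fixed) (column-ballot P)

    fixed-fromColumns : (g : Fin k → Fin (suc n)) (D : Ballot (g ∘ C.to)) →
                        path (act w (fromColumns (g ∘ C.to) D)) ≡ path (fromColumns (g ∘ C.to) D)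
    fixed-fromColumns g D = invariant⇒fixed w (fromColumns (g ∘ C.to) D) λ i → begin
      column (fromColumns (g ∘ C.to) D) (w ⟨$⟩ʳ i)  ≡⟨ column-fromColumns (g ∘ C.to) D (w ⟨$⟩ʳ i) ⟩
      g (C.to (w ⟨$⟩ʳ i))                           ≡⟨ cong g (C.to-cong (EqClosure.return refl)) ⟨
      g (C.to i)                                    ≡⟨ column-fromColumns (g ∘ C.to) D i ⟨
      column (fromColumns (g ∘ C.to) D) i           ∎
      where open ≡-Reasoning

  -- Each cycle is represented by its element under `C.from`; by `cycle-constant` the columns of
  -- these representatives determine all others.
  Fixed↔Ballot : Inverse (Fixed (suc n) w) (BallotVia n C.to)
  Fixed↔Ballot = mkInverse
    (λ (P , fixed) → column P ∘ C.from , ballot-on-cycles P fixed)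
    (λ (g , D) → fromColumns (g ∘ C.to) D , fixed-fromColumns g D)
    (λ {(P , _)} {(Q , _)} P≈Q → column-cong P Q P≈Q ∘ C.from)
    (λ {(_ , D)} {(_ , E)} g≗h → fromColumns-cong D E (g≗h ∘ C.to))
    (λ (g , D) j → trans (column-fromColumns (g ∘ C.to) D (C.from j)) (cong g (C.strictlyInverseˡ j)))
    (λ (P , fixed) → fromColumns-column P (ballot-on-cycles P fixed) (cycle-constant P fixed))

Fixed-size : Coprime (suc a) (suc n) → (w : Permutation′ (suc a)) (k : ℕ) → Cycles w HasSize k →
             Fixed (suc n) w HasSize (suc n ^ (k ∸ 1))
-- There is a label, hence a cycle, so the truncated `k ∸ 1` never meets `k = 0`.
Fixed-size cop w zero    cycles with () ← Inverse.to cycles zero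
Fixed-size cop w (suc k) cycles = inverse (Fixed↔Ballot w cycles) (BallotVia-size cop (Inverse.to cycles))

corollary4 : (a b : ℕ) → .{{_ : NonZero a}} → .{{_ : NonZero b}} → Coprime a b →
    ((w : Permutation′ a) (k : ℕ) → Cycles w HasSize k → Fixed b w HasSize (b ^ (k ∸ 1)))
    × (PF a b HasSize (b ^ (a ∸ 1)))
corollary4 (suc a) (suc n) cop = Fixed-size cop , inverse PF↔Ballot (BallotVia-size cop id)
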